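{- Let $G$ be an $r$-regular graph on $n$ vertices, where $n$ is even, and let $A$ be an Abelian group of order $n$ having exactly one involution (element of order 2). If $G$ is $A$-distance antimagic, then $r$ is odd.
   Context: All groups are finite Abelian, written additively. Let $G$ be a finite simple graph with $n$ vertices and $A$ an Abelian group of order $n$. For a bijection $f: V(G)\to A$, the weight of a vertex $x$ is $w_f(x)=\sum_{y\in N(x)} f(y)$, computed in $A$, where $N(x)$ is the open neighbourhood of $x$. $f$ is an $A$-distance antimagic labelling if the weights of all vertices are pairwise distinct; $f$ is an $A$-distance magic labelling if all vertices have the same weight (the magic constant). $G$ is $A$-distance antimagic (resp. magic) if it admits such a labelling. -}

module Defs where

open import Algebra.Bundles using (AbelianGroup)
open import Data.Fin.Base using (Fin)
open import Data.List.Base using (List; allFin; filter; foldr; length; map)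
open import Data.Nat.Base using (ℕ)
open import Data.Product.Base using (Σ-syntax; _×_)
open import Data.Product using (∃!)
open import Function.Bundles using (Bijection)
open import Level using (Level; 0ℓ; suc)
open import Relation.Binary.Core using (Rel)
open import Relation.Binary.Definitions using (Decidable; Irreflexive; Symmetric)
open import Relation.Binary.PropositionalEquality using (_≡_; _≢_; setoid)
open import Relation.Nullary.Negation using (¬_)

private
  variable
    c ℓ : Level
    n : ℕ

record SimpleGraph (n : ℕ) : Set (suc 0ℓ) where
  field
    Adj    : Rel (Fin n) 0ℓ
    adj?   : Decidable Adj
    sym    : Symmetric Adj
    irrefl : Irreflexive _≡_ Adj

  -- The open neighbourhood; since allFin lists every vertex once, so does
  -- this list for every neighbour of x.
  neighbours : Fin n → List (Fin n)
  neighbours x = filter (adj? x) (allFin n)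

  degree : Fin n → ℕ
  degree x = length (neighbours x)

Regular : ℕ → SimpleGraph n → Set
Regular r G = ∀ x → SimpleGraph.degree G x ≡ r

module _ (A : AbelianGroup c ℓ) where
  open AbelianGroup A renaming (_∙_ to _+_; ε to 0#; setoid to A-setoid)

  -- Elements of A are counted up to the group's own equality _≈_.
  HasOrder : ℕ → Set _
  HasOrder n = Bijection (setoid (Fin n)) A-setoid

  Involution : Carrier → Set ℓ
  Involution a = (¬ a ≈ 0#) × (a + a ≈ 0#)

  ExactlyOneInvolution : Set _
  ExactlyOneInvolution = ∃! _≈_ Involution

  Labelling : SimpleGraph n → Set _
  Labelling {n} _ = Bijection (setoid (Fin n)) A-setoid

  weight : (G : SimpleGraph n) → Labelling G → Fin n → Carrier
  weight G f x = foldr _+_ 0# (map (Bijection.to f) (SimpleGraph.neighbours G x))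

  IsDistanceAntimagicLabelling : (G : SimpleGraph n) → Labelling G → Set _
  IsDistanceAntimagicLabelling G f =
    ∀ x y → x ≢ y → ¬ weight G f x ≈ weight G f y

  DistanceAntimagic : SimpleGraph n → Set _
  DistanceAntimagic G = Σ[ f ∈ Labelling G ] IsDistanceAntimagicLabelling G f

{-# OPTIONS --safe #-}

-- Let S be the sum of all elements of A. Pairing every element with its
-- inverse shows that S is the unique involution ι. In an antimagic labelling
-- the weights run through A, so they add up to S; counting each label once per
-- neighbour, they also add up to r S. For even r this gives ι = S = r ι = 0.
module Submission where

open import Defs
open import Algebra.Bundles using (AbelianGroup)
open import Data.Bool.Base using (Bool; true; false; if_then_else_)
open import Data.Fin.Base using (Fin; zero; suc; punchOut)
open import Data.Fin.Permutation as Perm using (Permutation′)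
open import Data.Fin.Properties using (_≟_; _<?_; <-cmp; any?; punchOut-injective; injective⇒≤)
open import Data.List.Base using (List; []; _∷_; filter; foldr; length; map; tabulate)
open import Data.Nat.Base using (ℕ; zero; suc; parity)
open import Data.Nat.Properties using (1+n≰n)
open import Data.Parity.Base using (0ℙ; 1ℙ)
open import Data.Product.Base using (∃; _,_; proj₁; proj₂)
open import Function.Base using (_∘_; const)
open import Function.Bundles using (Bijection; mk⇔)
open import Function.Definitions using (Injective)
open import Level using (Level)
open import Relation.Binary.Definitions using (tri<; tri≈; tri>)
open import Relation.Binary.PropositionalEquality as ≡ using (_≡_; _≢_; setoid)
open import Relation.Nullary.Decidable
  using (does; yes; no; dec-true; dec-false; decidable-stable; does-⇔)
open import Relation.Nullary.Negation using (contradiction)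
open import Relation.Unary using (Decidable; Pred)

private
  variable
    n : ℕ

-- Pigeonhole: if `f` missed `j`, punching `j` out of the codomain would leave an injection from
-- `Fin (suc n)` into `Fin n`.
injective⇒surjective : (f : Fin n → Fin n) → Injective _≡_ _≡_ f → ∀ j → ∃ λ i → f i ≡ j
injective⇒surjective {suc n} f inj j with any? (λ i → f i ≟ j)
... | yes hit  = hit
... | no  miss = contradiction (injective⇒≤ avoid-injective) 1+n≰n
  where
  j≢f : ∀ i → j ≢ f i
  j≢f i j≡fi = miss (i , ≡.sym j≡fi)

  avoid-injective : Injective _≡_ _≡_ (λ i → punchOut (j≢f i))
  avoid-injective {x} {y} eq = inj (punchOut-injective (j≢f x) (j≢f y) eq)

injective⇒permutation : (f : Fin n → Fin n) → Injective _≡_ _≡_ f → Permutation′ n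
injective⇒permutation f inj = Perm.permutation f (proj₁ ∘ surj) (proj₂ ∘ surj) (λ i → inj (proj₂ (surj (f i))))
  where surj = injective⇒surjective f inj

module _ {c ℓ : Level} (A : AbelianGroup c ℓ) where
  open AbelianGroup A
    renaming (_∙_ to _+_; ε to 0#; _⁻¹ to -_; ∙-cong to +-cong; ∙-congˡ to +-congˡ; ∙-congʳ to +-congʳ;
              identityˡ to +-identityˡ; identityʳ to +-identityʳ; ⁻¹-cong to -‿cong;
              inverseˡ to -‿inverseˡ; inverseʳ to -‿inverseʳ; setoid to A-setoid)
  open import Algebra.Properties.Group group using (inverseˡ-unique; ⁻¹-involutive)
  open import Algebra.Properties.CommutativeMonoid.Sum commutativeMonoid
  open import Algebra.Properties.CommutativeMonoid.Mult commutativeMonoid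
  open import Relation.Binary.Reasoning.Setoid A-setoid

  infix 5 _when_
  -- An Iverson bracket with values in the group. It turns a sum over a sublist into a sum over all
  -- of `Fin n`, which can then be reindexed, split or exchanged with another sum.
  _when_ : Carrier → Bool → Carrier
  a when b = if b then a else 0#

  -- Stated for `tabulate h` because the induction replaces `h` by `h ∘ suc`; `allFin` is the case
  -- where `h` is the identity.
  sum-filter : ∀ {m p} {X : Set} {P : Pred X p} (P? : Decidable P) (f : X → Carrier) (h : Fin m → X) →
               foldr _+_ 0# (map f (filter P? (tabulate h))) ≈ ∑[ i < m ] (f (h i) when does (P? (h i)))
  sum-filter {zero}  P? f h = refl
  sum-filter {suc m} P? f h with does (P? (h zero))
  ... | true  = +-congˡ (sum-filter P? f (h ∘ suc))
  ... | false = trans (sum-filter P? f (h ∘ suc)) (sym (+-identityˡ _))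

  foldr-const : ∀ {X : Set} a (xs : List X) → foldr _+_ 0# (map (const a) xs) ≈ length xs × a
  foldr-const a []       = refl
  foldr-const a (_ ∷ xs) = +-congˡ (foldr-const a xs)

  sum-indicator : ∀ a (k : Fin n) → ∑[ i < n ] (a when does (i ≟ k)) ≈ a
  sum-indicator {suc n} a zero    = trans (+-congˡ (sum-replicate-zero n)) (+-identityʳ a)
  sum-indicator {suc n} a (suc k) = trans (+-identityˡ _) (sum-indicator a k)

  sum-scale : ∀ r (f : Fin n → Carrier) → ∑[ i < n ] (r × f i) ≈ r × sum f
  sum-scale {n} zero    f = sum-replicate-zero n
  sum-scale {n} (suc r) f = trans (∑-distrib-+ f (λ i → r × f i)) (+-congˡ (sum-scale r f))

  even-multiple : ∀ r {a} → parity r ≡ 0ℙ → a + a ≈ 0# → r × a ≈ 0#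
  even-multiple zero          _    _    = refl
  -- `parity` discards two successors at a time, so `even` also serves for `r`.
  even-multiple (suc (suc r)) {a} even 2a≈0 = begin
    a + (a + r × a) ≈⟨ assoc a a (r × a) ⟨
    (a + a) + r × a ≈⟨ +-cong 2a≈0 (even-multiple r even 2a≈0) ⟩
    0# + 0#         ≈⟨ +-identityˡ 0# ⟩
    0#              ∎

  -- The pairs {i, σ i} with i ≠ σ i cancel.
  sum-fixedPoints : (g : Fin n → Carrier) (σ : Fin n → Fin n) → (∀ i → σ (σ i) ≡ i) →
                    (∀ i → g (σ i) ≈ - g i) → sum g ≈ ∑[ i < n ] (g i when does (σ i ≟ i))
  sum-fixedPoints {n} g σ σ-involutive g-σ = begin
    sum g                             ≈⟨ sum-cong-≋ split ⟩
    sum (λ i → E i + (L i + R i))     ≈⟨ ∑-distrib-+ E (λ i → L i + R i) ⟩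
    sum E + sum (λ i → L i + R i)     ≈⟨ +-congˡ (∑-distrib-+ L R) ⟩
    -- Reindexing by `σ` moves each upper element of a pair to the index of its lower partner: the
    -- condition of `R (σ i)` is `σ (σ i) < σ i`, which is that of `L i`.
    sum E + (sum L + sum R)           ≈⟨ +-congˡ (+-congˡ (sum-permute R π)) ⟩
    sum E + (sum L + sum (R ∘ σ))     ≈⟨ +-congˡ (∑-distrib-+ L (R ∘ σ)) ⟨
    sum E + sum (λ i → L i + R (σ i)) ≈⟨ +-congˡ (sum-cong-≋ cancel) ⟩
    sum E + sum {n} (λ _ → 0#)        ≈⟨ +-congˡ (sum-replicate-zero n) ⟩
    sum E + 0#                        ≈⟨ +-identityʳ _ ⟩
    sum E                             ∎
    where
    π : Permutation′ n
    π = Perm.permutation σ σ σ-involutive σ-involutive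

    -- Fixed points of `σ`, and the lower and upper members of its two-element orbits; the order on
    -- `Fin n` chooses a representative of each orbit.
    E L R : Fin n → Carrier
    E i = g i when does (σ i ≟ i)
    L i = g i when does (i <? σ i)
    R i = g i when does (σ i <? i)

    split : ∀ i → g i ≈ E i + (L i + R i)
    split i with <-cmp i (σ i)
    ... | tri< i<σi i≢σi i≯σi
      rewrite dec-false (σ i ≟ i) (i≢σi ∘ ≡.sym) | dec-true (i <? σ i) i<σi | dec-false (σ i <? i) i≯σi
      = sym (trans (+-identityˡ _) (+-identityʳ _))
    ... | tri≈ i≮σi i≡σi i≯σi
      rewrite dec-true (σ i ≟ i) (≡.sym i≡σi) | dec-false (i <? σ i) i≮σi | dec-false (σ i <? i) i≯σi
      = sym (trans (+-congˡ (+-identityˡ _)) (+-identityʳ _))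
    ... | tri> i≮σi i≢σi i>σi
      rewrite dec-false (σ i ≟ i) (i≢σi ∘ ≡.sym) | dec-false (i <? σ i) i≮σi | dec-true (σ i <? i) i>σi
      = sym (trans (+-identityˡ _) (+-identityˡ _))

    cancel : ∀ i → L i + R (σ i) ≈ 0#
    cancel i rewrite σ-involutive i with does (i <? σ i)
    ... | true  = trans (+-congˡ (g-σ i)) (-‿inverseʳ (g i))
    ... | false = +-identityˡ 0#

  module _ (f : Bijection (setoid (Fin n)) A-setoid) where
    open Bijection f using (to; injective; strictlySurjective)

    from : Carrier → Fin n
    from a = proj₁ (strictlySurjective a)

    to-from : ∀ a → to (from a) ≈ a
    to-from a = proj₂ (strictlySurjective a)

    -- Distinct values of `w`, as many as the group has elements, enumerate the group: `from ∘ w` is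
    -- an injective self-map of `Fin n`, hence a permutation, and `w` is `to` reindexed by it.
    sum-injective : (w : Fin n → Carrier) → (∀ {x y} → w x ≈ w y → x ≡ y) → sum w ≈ sum to
    sum-injective w w-injective = begin
      sum w               ≈⟨ sum-cong-≋ (λ x → sym (to-from (w x))) ⟩
      sum (to ∘ from ∘ w) ≈⟨ sum-permute to π ⟨
      sum to              ∎
      where
      π : Permutation′ n
      π = injective⇒permutation (from ∘ w) λ {x} {y} eq → w-injective (begin
        w x             ≈⟨ to-from (w x) ⟨
        to (from (w x)) ≡⟨ ≡.cong to eq ⟩
        to (from (w y)) ≈⟨ to-from (w y) ⟩
        w y             ∎)

    -- Negation, transported to indices as `σ`, fixes just the solutions of `a + a ≈ 0#`, namely
    -- `0#` and `ι`. Since `0#` contributes nothing, the sum over the fixed points collapses to `ι`.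
    sum-uniqueInvolution : ((ι , _) : ExactlyOneInvolution A) → sum to ≈ ι
    sum-uniqueInvolution (ι , (ι≉0 , 2ι≈0) , ι-unique) = begin
      sum to                                ≈⟨ sum-fixedPoints to σ σ-involutive (λ i → to-from (- to i)) ⟩
      ∑[ i < n ] (to i when does (σ i ≟ i)) ≈⟨ sum-cong-≋ fixed ⟩
      ∑[ i < n ] (ι when does (i ≟ k))      ≈⟨ sum-indicator ι k ⟩
      ι                                     ∎
      where
      σ : Fin n → Fin n
      σ i = from (- to i)

      k : Fin n
      k = from ι

      σ-involutive : ∀ i → σ (σ i) ≡ i
      σ-involutive i = injective (begin
        to (σ (σ i)) ≈⟨ to-from _ ⟩
        - to (σ i)   ≈⟨ -‿cong (to-from _) ⟩
        - - to i     ≈⟨ ⁻¹-involutive (to i) ⟩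
        to i         ∎)

      σk≡k : σ k ≡ k
      σk≡k = injective (begin
        to (σ k) ≈⟨ to-from _ ⟩
        - to k   ≈⟨ -‿cong (to-from ι) ⟩
        - ι      ≈⟨ inverseˡ-unique ι ι 2ι≈0 ⟨
        ι        ≈⟨ to-from ι ⟨
        to k     ∎)

      fixed⇒2to≈0 : ∀ {i} → σ i ≡ i → to i + to i ≈ 0#
      fixed⇒2to≈0 {i} σi≡i = begin
        to i + to i     ≡⟨ ≡.cong (λ j → to j + to i) σi≡i ⟨
        to (σ i) + to i ≈⟨ +-congʳ (to-from _) ⟩
        - to i + to i   ≈⟨ -‿inverseˡ (to i) ⟩
        0#              ∎

      fixed : ∀ i → (to i when does (σ i ≟ i)) ≈ (ι when does (i ≟ k))
      fixed i with i ≟ k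
      ... | yes ≡.refl rewrite dec-true (σ k ≟ k) σk≡k = to-from ι
      ... | no i≢k with σ i ≟ i
      ...   | no  _    = refl
      -- Whether the label is zero is decided on indices, where equality is decidable. A nonzero
      -- label fixed by negation is an involution, hence `ι`, which would force `i ≡ k`.
      ...   | yes σi≡i with i ≟ from 0#
      ...     | yes i≡z = trans (reflexive (≡.cong to i≡z)) (to-from 0#)
      ...     | no  i≢z = contradiction (injective (trans (sym ι≈to-i) (sym (to-from ι)))) i≢k
        where
        ι≈to-i : ι ≈ to i
        ι≈to-i = ι-unique ((λ to-i≈0 → i≢z (injective (trans to-i≈0 (sym (to-from 0#))))) , fixed⇒2to≈0 σi≡i)

  -- Double counting of ordered adjacent pairs: summed by its second vertex `y` instead of its
  -- first, the label of `y` occurs `degree y` times.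
  sum-weight : ∀ {r} (G : SimpleGraph n) → Regular r G → (f : Labelling A G) →
               sum (weight A G f) ≈ r × sum (Bijection.to f)
  sum-weight {n} {r} G regular f = begin
    sum (weight A G f)
      ≈⟨ sum-cong-≋ (λ x → sum-filter (adj? x) to (λ y → y)) ⟩
    ∑[ x < n ] ∑[ y < n ] (to y when does (adj? x y))
      ≈⟨ ∑-comm (λ x y → to y when does (adj? x y)) ⟩
    ∑[ y < n ] ∑[ x < n ] (to y when does (adj? x y))
      ≈⟨ sum-cong-≋ (λ y → sum-cong-≋ (λ x → swap x y)) ⟩
    ∑[ y < n ] ∑[ x < n ] (to y when does (adj? y x))
      -- The summand no longer depends on `x`, so the indicators fold back into a constant sum along
      -- the neighbours of `y`, and only their number matters.
      ≈⟨ sum-cong-≋ (λ y → sum-filter (adj? y) (const (to y)) (λ x → x)) ⟨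
    ∑[ y < n ] foldr _+_ 0# (map (const (to y)) (neighbours y))
      ≈⟨ sum-cong-≋ (λ y → foldr-const (to y) (neighbours y)) ⟩
    ∑[ y < n ] (degree y × to y)
      ≈⟨ sum-cong-≋ (λ y → ×-congˡ (regular y)) ⟩
    ∑[ y < n ] (r × to y)
      ≈⟨ sum-scale r to ⟩
    r × sum to ∎
    where
    open Bijection f using (to)
    open SimpleGraph G using (adj?; neighbours; degree) renaming (sym to Adj-sym)

    swap : ∀ x y → (to y when does (adj? x y)) ≈ (to y when does (adj? y x))
    swap x y = reflexive (≡.cong (to y when_) (does-⇔ (mk⇔ Adj-sym Adj-sym) (adj? x y) (adj? y x)))

mainTheorem1 : ∀ {c ℓ : Level} (n r : ℕ) (G : SimpleGraph n) (A : AbelianGroup c ℓ) →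
    Regular r G →
    parity n ≡ 0ℙ →
    HasOrder A n →
    ExactlyOneInvolution A →
    DistanceAntimagic A G →
    parity r ≡ 1ℙ
mainTheorem1 n r G A regular _ _ one@(ι , (ι≉0 , 2ι≈0) , _) (f , antimagic) with parity r in parity-r
... | 1ℙ = ≡.refl
... | 0ℙ = contradiction ι≈0 ι≉0
  where
  open AbelianGroup A using (_≈_; commutativeMonoid) renaming (ε to 0#; setoid to A-setoid)
  open import Algebra.Properties.CommutativeMonoid.Sum commutativeMonoid using (sum)
  open import Algebra.Properties.CommutativeMonoid.Mult commutativeMonoid using (_×_; ×-congʳ)
  open import Relation.Binary.Reasoning.Setoid A-setoid
  open Bijection f using (to)

  weight-injective : ∀ {x y} → weight A G f x ≈ weight A G f y → x ≡ y
  -- Antimagic only refutes equal weights at distinct vertices; decidable equality of vertices turns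
  -- this into injectivity.
  weight-injective {x} {y} eq = decidable-stable (x ≟ y) λ x≢y → antimagic x y x≢y eq

  ι≈0 : ι ≈ 0#
  ι≈0 = begin
    ι                  ≈⟨ sum-uniqueInvolution A f one ⟨
    sum to             ≈⟨ sum-injective A f (weight A G f) weight-injective ⟨
    sum (weight A G f) ≈⟨ sum-weight A G regular f ⟩
    r × sum to         ≈⟨ ×-congʳ r (sum-uniqueInvolution A f one) ⟩
    r × ι              ≈⟨ even-multiple A r parity-r 2ι≈0 ⟩
    0#                 ∎
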